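{- For $n,a\in\mathbb{N}$ with $n\ge 1$ and $1\le a\le n+1$: $$\begin{aligned}[F_{n+1}]_{q} ={}& [F_{n-a+2}]_{q^{F_{a}}}\,[F_{a}]_{q}\\ &+[F_{a}]_{q}\sum_{i=1}^{\lfloor n/a\rfloor-1}\left\{ q^{F_{a}\sum_{j=1}^{i} F_{n-ja+2}}\left(\prod_{j=1}^{i}[F_{a-1}]_{q^{F_{n-ja+1}}}\right)[F_{n-(i+1)a+2}]_{q^{F_{a}}}\right\}\\ &+ q^{F_{a}\sum_{j=1}^{\lfloor n/a\rfloor} F_{n-ja+2}}\left(\prod_{j=1}^{\lfloor n/a\rfloor}[F_{a-1}]_{q^{F_{n-ja+1}}}\right)\left[F_{n-\lfloor n/a\rfloor a+1}\right]_{q}.\end{aligned}$$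
   Context: The Fibonacci numbers are defined by $F_0=0$, $F_1=1$, $F_n=F_{n-1}+F_{n-2}$. The $q$-analogue of the $n$-th Fibonacci number is $[F_n]_q=\sum_{i=0}^{F_n-1}q^i$ (so $[F_0]_q=0$), where $q$ is an indeterminate; $[F_n]_{q^s}=\sum_{i=0}^{F_n-1}q^{si}$ denotes the same expression with $q$ replaced by $q^s$. The symbol $\lfloor x\rfloor$ denotes the greatest integer not exceeding $x$.
   Formalization: For a = n+1 the sum runs from i=1 to −1; with an empty sum equal to 0 the printed identity fails (n=1, a=2 gives 1=2), so there the sum is read as minus the i=0 term; for 1 ≤ a ≤ n it is the ordinary sum. -}

module Defs where

open import Algebra.Bundles.Raw using (RawMonoid; RawRing)
import Algebra.Definitions.RawMonoid as RawMonoidDefs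
import Algebra.Definitions.RawSemiring as RawSemiringDefs
open import Data.Fin.Base using (toℕ)
open import Data.Integer.Base as ℤ using (ℤ; 0ℤ; 1ℤ)
open import Data.List.Base using (List; []; _∷_; map)
open import Data.Nat.Base as ℕ using (ℕ; zero; suc; _∸_)
open import Level using (0ℓ)
open import Relation.Binary.PropositionalEquality using (_≡_)

fib : ℕ → ℕ
fib 0             = 0
fib 1             = 1
fib (suc (suc n)) = fib (suc n) ℕ.+ fib n

-- ℤ[q]: a polynomial is its list of coefficients, constant term first.
-- Trailing zeros are allowed, so equality of polynomials is _≈ₚ_ and not _≡_.

Poly : Set
Poly = List ℤ

coeff : Poly → ℕ → ℤ
coeff []      _       = 0ℤ
coeff (c ∷ _) zero    = c
coeff (_ ∷ p) (suc k) = coeff p k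

infix 4 _≈ₚ_

_≈ₚ_ : Poly → Poly → Set
p ≈ₚ r = ∀ k → coeff p k ≡ coeff r k

infix  8 -ₚ_
infixl 7 _*ₚ_
infixl 6 _+ₚ_ _-ₚ_

_+ₚ_ : Poly → Poly → Poly
[]      +ₚ r       = r
(c ∷ p) +ₚ []      = c ∷ p
(c ∷ p) +ₚ (d ∷ r) = (c ℤ.+ d) ∷ (p +ₚ r)

-ₚ_ : Poly → Poly
-ₚ p = map (λ c → ℤ.- c) p

_-ₚ_ : Poly → Poly → Poly
p -ₚ r = p +ₚ (-ₚ r)

-- (c + q p) r = c r + q (p r)
_*ₚ_ : Poly → Poly → Poly
[]      *ₚ r = []
(c ∷ p) *ₚ r = map (c ℤ.*_) r +ₚ (0ℤ ∷ (p *ₚ r))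

q : Poly
q = 0ℤ ∷ 1ℤ ∷ []

ℤ[q] : RawRing 0ℓ 0ℓ
ℤ[q] = record
  { Carrier = Poly
  ; _≈_     = _≈ₚ_
  ; _+_     = _+ₚ_
  ; _*_     = _*ₚ_
  ; -_      = -ₚ_
  ; 0#      = []
  ; 1#      = 1ℤ ∷ []
  }

open RawSemiringDefs (RawRing.rawSemiring ℤ[q]) public
  using () renaming (_^_ to infixr 8 _^ₚ_)

-- The terms f i with l ≤ i < u, combined in increasing order of i.
module _ {c ℓ} (M : RawMonoid c ℓ) where
  open RawMonoid M using (Carrier)

  foldRange : ℕ → ℕ → (ℕ → Carrier) → Carrier
  foldRange l u f = RawMonoidDefs.sum M {u ∸ l} (λ k → f (l ℕ.+ toℕ k))

∑ℕ : ℕ → ℕ → (ℕ → ℕ) → ℕ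
∑ℕ = foldRange ℕ.+-0-rawMonoid

∑ₚ ∏ₚ : ℕ → ℕ → (ℕ → Poly) → Poly
∑ₚ = foldRange (RawRing.+-rawMonoid ℤ[q])
∏ₚ = foldRange (RawRing.*-rawMonoid ℤ[q])

-- Summation with signed range: for l ≤ u this is the ordinary sum of the f i
-- with l ≤ i < u (the second sum is empty), and for u < l it is
-- − (f u + … + f (l − 1)) (the first sum is empty).  This is the extension
-- for which  ∑ from l to u  plus  ∑ from u to v  is always  ∑ from l to v,
-- so a sum from i = 1 to −1 is − f 0.
∑± : ℕ → ℕ → (ℕ → Poly) → Poly
∑± l u f = ∑ₚ l u f -ₚ ∑ₚ u l f

syntax ∑ℕ l u (λ i → e) = ∑ℕ[ l ≤ i < u ] e
syntax ∏ₚ l u (λ i → e) = ∏ₚ[ l ≤ i < u ] e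
syntax ∑± l u (λ i → e) = ∑±[ l ≤ i < u ] e

-- ⟦ m ⟧ x = 1 + x + … + x^(m − 1); thus [F_n]_{q^s} is ⟦ fib n ⟧ (q ^ₚ s).
⟦_⟧ : ℕ → Poly → Poly
⟦ m ⟧ x = ∑ₚ 0 m (λ i → x ^ₚ i)

{-# OPTIONS --safe #-}

-- Put a = b + 1.  Since F_{a+d} = F_a F_{d+1} + F_b F_d, splitting a geometric
-- sum of that length gives
--   [F_{a+d}]_q = [F_a]_q [F_{d+1}]_{q^{F_a}}
--                 + q^{F_a F_{d+1}} [F_b]_{q^{F_d}} [F_d]_q.
-- Applied to the factor [F_{n-ia+1}]_q of the last term of the formula
-- truncated at i, it produces the summand of index i and the last term
-- truncated at i + 1, so the formula telescopes.  The leading term is the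
-- summand of index 0; it also absorbs the empty case n < a, where the signed
-- sum is minus that summand.
module Submission where

open import Algebra.Bundles using (CommutativeRing; Monoid)
open import Algebra.Definitions
  using (Congruent₁; Congruent₂; Associative; Commutative; LeftIdentity; _DistributesOverʳ_)
import Algebra.Consequences.Setoid as Consequences
open import Algebra.Structures using (IsCommutativeRing)
import Algebra.Properties.Ring as RingProperties
import Algebra.Properties.Semiring.Exp as Exp
import Algebra.Properties.Semiring.Sum as Sum
import Algebra.Solver.Ring.NaturalCoefficients.Default as SemiringSolver
open import Data.Fin.Base using (toℕ)
import Data.Integer.Base as ℤ
open ℤ using (ℤ; 0ℤ; 1ℤ)
import Data.Integer.Properties as ℤ
open import Data.Integer.Solver using (module +-*-Solver)
open import Data.List.Base using ([]; _∷_; map)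
open import Data.Nat.DivMod using (m/n*n≤m)
import Data.Nat.Properties as ℕ
open import Data.Nat.Solver using () renaming (module +-*-Solver to ℕ-Solver)
open import Function.Base using (_∘_)
open import Level using (0ℓ)
open import Relation.Binary.Bundles using (Setoid)
open import Relation.Binary.PropositionalEquality as ≡ using (_≡_; _≗_; cong; cong₂)
import Relation.Binary.Reasoning.Setoid as SetoidReasoning

open import Defs
open import Data.Nat.Base using (ℕ; NonZero; zero; suc; _+_; _*_; _∸_; _/_; _≤_)

-- Convolution of integer sequences.

infixl 7 _⊛_

-- The Cauchy product, with the same recursion on the left factor as `_*ₚ_`. On sequences, equality
-- up to trailing zeros is pointwise equality, so the multiplicative laws are proved here and
-- carried to lists by `coeff-*`.
_⊛_ : (ℕ → ℤ) → (ℕ → ℤ) → ℕ → ℤ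
(u ⊛ v) zero    = u 0 ℤ.* v 0
(u ⊛ v) (suc k) = u 0 ℤ.* v (suc k) ℤ.+ (u ∘ suc ⊛ v) k

⊛-cong : ∀ {u u′ v v′} → u ≗ u′ → v ≗ v′ → u ⊛ v ≗ u′ ⊛ v′
⊛-cong u≗u′ v≗v′ zero    = cong₂ ℤ._*_ (u≗u′ 0) (v≗v′ 0)
⊛-cong u≗u′ v≗v′ (suc k) =
  cong₂ ℤ._+_ (cong₂ ℤ._*_ (u≗u′ 0) (v≗v′ (suc k))) (⊛-cong (u≗u′ ∘ suc) v≗v′ k)

⊛-zeroˡ : ∀ v → (λ _ → 0ℤ) ⊛ v ≗ λ _ → 0ℤ
⊛-zeroˡ v zero    = ≡.refl
⊛-zeroˡ v (suc k) = ≡.trans (ℤ.+-identityˡ _) (⊛-zeroˡ v k)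

⊛-scaleˡ : ∀ c u v → (λ k → c ℤ.* u k) ⊛ v ≗ λ k → c ℤ.* (u ⊛ v) k
⊛-scaleˡ c u v zero    = ℤ.*-assoc c (u 0) (v 0)
⊛-scaleˡ c u v (suc k) rewrite ⊛-scaleˡ c (u ∘ suc) v k =
  solve 4 (λ x y z w → x :* y :* z :+ x :* w := x :* (y :* z :+ w)) ≡.refl
    c (u 0) (v (suc k)) ((u ∘ suc ⊛ v) k)
  where open +-*-Solver

⊛-distribʳ : ∀ w u v → (λ k → u k ℤ.+ v k) ⊛ w ≗ λ k → (u ⊛ w) k ℤ.+ (v ⊛ w) k
⊛-distribʳ w u v zero    = ℤ.*-distribʳ-+ (w 0) (u 0) (v 0)
⊛-distribʳ w u v (suc k) rewrite ⊛-distribʳ w (u ∘ suc) (v ∘ suc) k =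
  solve 5 (λ x y z s t → (x :+ y) :* z :+ (s :+ t) := x :* z :+ s :+ (y :* z :+ t)) ≡.refl
    (u 0) (v 0) (w (suc k)) ((u ∘ suc ⊛ w) k) ((v ∘ suc ⊛ w) k)
  where open +-*-Solver

-- The definition splits off the term with `u 0`; this splits off the one with `v 0`, at the other
-- end of the convolution. Playing the two against each other gives commutativity.
⊛-sucʳ : ∀ u v k → (u ⊛ v) (suc k) ≡ (u ⊛ v ∘ suc) k ℤ.+ u (suc k) ℤ.* v 0
⊛-sucʳ u v zero    = ≡.refl
⊛-sucʳ u v (suc k) rewrite ⊛-sucʳ (u ∘ suc) v k = ≡.sym (ℤ.+-assoc (u 0 ℤ.* v (suc (suc k))) _ _)

⊛-comm : ∀ u v → u ⊛ v ≗ v ⊛ u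
⊛-comm u v zero    = ℤ.*-comm (u 0) (v 0)
⊛-comm u v (suc k) rewrite ⊛-sucʳ v u k | ⊛-comm (u ∘ suc) v k | ℤ.*-comm (u 0) (v (suc k)) =
  ℤ.+-comm (v (suc k) ℤ.* u 0) _

-- The tail of `u ⊛ v` is `u 0` times the tail of `v`, plus `u ∘ suc ⊛ v`. Linearity of `⊛` in its
-- left argument then reduces the claim to the induction hypothesis.
⊛-assoc : ∀ u v w → (u ⊛ v) ⊛ w ≗ u ⊛ (v ⊛ w)
⊛-assoc u v w zero    = ℤ.*-assoc (u 0) (v 0) (w 0)
⊛-assoc u v w (suc k) rewrite
    ⊛-distribʳ w (λ j → u 0 ℤ.* v (suc j)) (u ∘ suc ⊛ v) k
  | ⊛-scaleˡ (u 0) (v ∘ suc) w k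
  | ⊛-assoc (u ∘ suc) v w k =
  solve 5 (λ x y z s t → x :* y :* z :+ (x :* s :+ t) := x :* (y :* z :+ s) :+ t) ≡.refl
    (u 0) (v 0) (w (suc k)) ((v ∘ suc ⊛ w) k) ((u ∘ suc ⊛ (v ⊛ w)) k)
  where open +-*-Solver

-- Coefficients of sums, negatives and products.

coeff-+ : ∀ p r k → coeff (p +ₚ r) k ≡ coeff p k ℤ.+ coeff r k
coeff-+ []      r       k       = ≡.sym (ℤ.+-identityˡ _)
coeff-+ (c ∷ p) []      k       = ≡.sym (ℤ.+-identityʳ _)
coeff-+ (c ∷ p) (d ∷ r) zero    = ≡.refl
coeff-+ (c ∷ p) (d ∷ r) (suc k) = coeff-+ p r k

-- The condition on `f` covers positions past the end of the list, where `coeff` is `0ℤ`.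
coeff-map : ∀ (f : ℤ → ℤ) → f 0ℤ ≡ 0ℤ → ∀ p k → coeff (map f p) k ≡ f (coeff p k)
coeff-map f f0≡0 []      k       = ≡.sym f0≡0
coeff-map f f0≡0 (c ∷ p) zero    = ≡.refl
coeff-map f f0≡0 (c ∷ p) (suc k) = coeff-map f f0≡0 p k

coeff-neg : ∀ p k → coeff (-ₚ p) k ≡ ℤ.- coeff p k
coeff-neg = coeff-map ℤ.-_ ≡.refl

coeff-* : ∀ p r → coeff (p *ₚ r) ≗ coeff p ⊛ coeff r
coeff-* []      r k    = ≡.sym (⊛-zeroˡ (coeff r) k)
coeff-* (c ∷ p) r k
  rewrite coeff-+ (map (c ℤ.*_) r) (0ℤ ∷ p *ₚ r) k
        | coeff-map (c ℤ.*_) (ℤ.*-zeroʳ c) r k with k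
... | zero  = ℤ.+-identityʳ _
... | suc j = cong (λ z → c ℤ.* coeff r (suc j) ℤ.+ z) (coeff-* p r j)

-- The commutative ring structure of `ℤ[q]`.

≈ₚ-setoid : Setoid 0ℓ 0ℓ
≈ₚ-setoid = record
  { Carrier       = Poly
  ; _≈_           = _≈ₚ_
  ; isEquivalence = record
    { refl  = λ _ → ≡.refl
    ; sym   = λ p≈r k → ≡.sym (p≈r k)
    ; trans = λ p≈r r≈s k → ≡.trans (p≈r k) (r≈s k)
    }
  }

+ₚ-cong : Congruent₂ _≈ₚ_ _+ₚ_
+ₚ-cong {p} {p′} {r} {r′} p≈p′ r≈r′ k rewrite coeff-+ p r k | coeff-+ p′ r′ k =
  cong₂ ℤ._+_ (p≈p′ k) (r≈r′ k)

+ₚ-assoc : Associative _≈ₚ_ _+ₚ_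
+ₚ-assoc p r s k
  rewrite coeff-+ (p +ₚ r) s k | coeff-+ p r k | coeff-+ p (r +ₚ s) k | coeff-+ r s k =
  ℤ.+-assoc (coeff p k) (coeff r k) (coeff s k)

+ₚ-comm : Commutative _≈ₚ_ _+ₚ_
+ₚ-comm p r k rewrite coeff-+ p r k | coeff-+ r p k = ℤ.+-comm (coeff p k) (coeff r k)

-ₚ-inverseʳ : ∀ p → p +ₚ -ₚ p ≈ₚ []
-ₚ-inverseʳ p k rewrite coeff-+ p (-ₚ p) k | coeff-neg p k = ℤ.+-inverseʳ (coeff p k)

-ₚ-cong : Congruent₁ _≈ₚ_ (-ₚ_)
-ₚ-cong {p} {r} p≈r k rewrite coeff-neg p k | coeff-neg r k = cong ℤ.-_ (p≈r k)

*ₚ-cong : Congruent₂ _≈ₚ_ _*ₚ_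
*ₚ-cong {p} {p′} {r} {r′} p≈p′ r≈r′ k rewrite coeff-* p r k | coeff-* p′ r′ k =
  ⊛-cong p≈p′ r≈r′ k

*ₚ-comm : Commutative _≈ₚ_ _*ₚ_
*ₚ-comm p r k rewrite coeff-* p r k | coeff-* r p k = ⊛-comm (coeff p) (coeff r) k

*ₚ-assoc : Associative _≈ₚ_ _*ₚ_
*ₚ-assoc p r s k = begin
  coeff (p *ₚ r *ₚ s) k                   ≡⟨ coeff-* (p *ₚ r) s k ⟩
  (coeff (p *ₚ r) ⊛ coeff s) k            ≡⟨ ⊛-cong (coeff-* p r) (λ _ → ≡.refl) k ⟩
  (coeff p ⊛ coeff r ⊛ coeff s) k         ≡⟨ ⊛-assoc (coeff p) (coeff r) (coeff s) k ⟩
  (coeff p ⊛ (coeff r ⊛ coeff s)) k       ≡⟨ ⊛-cong (λ _ → ≡.refl) (coeff-* r s) k ⟨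
  (coeff p ⊛ coeff (r *ₚ s)) k            ≡⟨ coeff-* p (r *ₚ s) k ⟨
  coeff (p *ₚ (r *ₚ s)) k                 ∎
  where open ≡.≡-Reasoning

*ₚ-identityˡ : LeftIdentity _≈ₚ_ (1ℤ ∷ []) _*ₚ_
*ₚ-identityˡ p k rewrite coeff-* (1ℤ ∷ []) p k with k
... | zero  = ℤ.*-identityˡ _
... | suc j rewrite ⊛-zeroˡ (coeff p) j = ≡.trans (ℤ.+-identityʳ _) (ℤ.*-identityˡ _)

*ₚ-distribʳ-+ₚ : _DistributesOverʳ_ _≈ₚ_ _*ₚ_ _+ₚ_
*ₚ-distribʳ-+ₚ s p r k
  rewrite coeff-* (p +ₚ r) s k
        | ⊛-cong {v = coeff s} (coeff-+ p r) (λ _ → ≡.refl) k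
        | coeff-+ (p *ₚ s) (r *ₚ s) k | coeff-* p s k | coeff-* r s k =
  ⊛-distribʳ (coeff s) (coeff p) (coeff r) k

ℤ[q]-isCommutativeRing : IsCommutativeRing _≈ₚ_ _+ₚ_ _*ₚ_ (-ₚ_) [] (1ℤ ∷ [])
ℤ[q]-isCommutativeRing = record
  { isRing = record
    { +-isAbelianGroup = record
      { isGroup = record
        { isMonoid = record
          { isSemigroup = record
            { isMagma = record
              { isEquivalence = Setoid.isEquivalence ≈ₚ-setoid
              ; ∙-cong        = λ {p} {p′} {r} {r′} → +ₚ-cong {p} {p′} {r} {r′}
              }
            ; assoc = +ₚ-assoc
            }
          ; identity = comm∧idˡ⇒id {_+ₚ_} +ₚ-comm {[]} (λ _ _ → ≡.refl)
          }
        ; inverse = comm∧invʳ⇒inv {_+ₚ_} { -ₚ_ } {[]} +ₚ-comm -ₚ-inverseʳ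
        ; ⁻¹-cong = λ {p} {r} → -ₚ-cong {p} {r}
        }
      ; comm = +ₚ-comm
      }
    ; *-cong     = λ {p} {p′} {r} {r′} → *ₚ-cong {p} {p′} {r} {r′}
    ; *-assoc    = *ₚ-assoc
    ; *-identity = comm∧idˡ⇒id {_*ₚ_} *ₚ-comm {1ℤ ∷ []} *ₚ-identityˡ
    ; distrib    = comm∧distrʳ⇒distr {_*ₚ_} {_+ₚ_}
                     (λ {p} {p′} {r} {r′} → +ₚ-cong {p} {p′} {r} {r′}) *ₚ-comm *ₚ-distribʳ-+ₚ
    }
  ; *-comm = *ₚ-comm
  }
  where open Consequences ≈ₚ-setoid

ℤ[q]-commutativeRing : CommutativeRing 0ℓ 0ℓ
ℤ[q]-commutativeRing = record { isCommutativeRing = ℤ[q]-isCommutativeRing }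

-- Fibonacci addition and index arithmetic.

-- Both sides satisfy the Fibonacci recurrence in `m`, so two base cases suffice. Stating it at
-- `suc m` makes `fib m` the preceding number without any subtraction.
fib-+ : ∀ m n → fib (suc m + n) ≡ fib (suc m) * fib (suc n) + fib m * fib n
fib-+ zero          n = ≡.sym (≡.trans (ℕ.+-identityʳ _) (ℕ.*-identityˡ _))
fib-+ (suc zero)    n =
  ≡.sym (cong₂ _+_ (ℕ.*-identityˡ (fib (suc n))) (ℕ.*-identityˡ (fib n)))
fib-+ (suc (suc m)) n rewrite fib-+ (suc m) n | fib-+ m n =
  solve 4 (λ x y s t → ((x :+ y) :* s :+ x :* t) :+ (x :* s :+ y :* t)
                    := ((x :+ y) :+ x) :* s :+ (x :+ y) :* t) ≡.refl
    (fib (suc m)) (fib m) (fib (suc n)) (fib n)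
  where open ℕ-Solver

n∸m≡o+[n∸[o+m]] : ∀ n m o → o + m ≤ n → n ∸ m ≡ o + (n ∸ (o + m))
n∸m≡o+[n∸[o+m]] n m o o+m≤n = begin
  n ∸ m              ≡⟨ ℕ.m+[n∸m]≡n (ℕ.m+n≤o⇒m≤o∸n o o+m≤n) ⟨
  o + (n ∸ m ∸ o)    ≡⟨ cong (o +_) (ℕ.∸-+-assoc n m o) ⟩
  o + (n ∸ (m + o))  ≡⟨ cong (λ k → o + (n ∸ k)) (ℕ.+-comm m o) ⟩
  o + (n ∸ (o + m))  ∎
  where open ≡.≡-Reasoning

-- Appending a last term to a range.

module _ {c ℓ} (M : Monoid c ℓ) where
  open Monoid M

  -- The fold unfolds at its first term, whereas telescoping appends at the end; associativity moves
  -- between the two.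
  foldRange-snoc : ∀ k (f : ℕ → Carrier) →
                   foldRange rawMonoid 0 (suc k) f ≈ foldRange rawMonoid 0 k f ∙ f k
  foldRange-snoc zero    f = trans (identityʳ (f 0)) (sym (identityˡ (f 0)))
  foldRange-snoc (suc k) f = trans (∙-congˡ (foldRange-snoc k (f ∘ suc))) (sym (assoc _ _ _))

  foldRange-snoc₁ : ∀ i (f : ℕ → Carrier) →
                    foldRange rawMonoid 1 (suc i + 1) f ≈ foldRange rawMonoid 1 (i + 1) f ∙ f (suc i)
  foldRange-snoc₁ i f rewrite ℕ.+-comm i 1 = foldRange-snoc i (f ∘ suc)

-- Geometric sums in a commutative ring.

module _ {c ℓ} (R : CommutativeRing c ℓ) where
  open CommutativeRing R
    renaming (_+_ to infixl 6 _⊕_; _*_ to infixl 7 _⊗_; _-_ to infixl 6 _⊖_; -_ to ⊖_)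
  open Exp semiring using (_^_; ^-homo-*)
  open Sum semiring using (*-distribˡ-sum)
  open SemiringSolver commutativeSemiring using (solve; _:+_; _:*_; _:=_)
  open SetoidReasoning setoid

  -- At `ℤ[q]` this is `⟦_⟧` by definition, so the final identity is an instance of the abstract
  -- one.
  geom : ℕ → Carrier → Carrier
  geom m x = foldRange +-rawMonoid 0 m (x ^_)

  geom-suc : ∀ m x → geom (suc m) x ≈ 1# ⊕ x ⊗ geom m x
  geom-suc m x = +-congˡ (sym (*-distribˡ-sum {n = m} x (λ k → x ^ toℕ k)))

  geom-+ : ∀ m n x → geom (m + n) x ≈ geom m x ⊕ x ^ m ⊗ geom n x
  geom-+ zero    n x = sym (trans (+-identityˡ _) (*-identityˡ _))
  geom-+ (suc m) n x = begin
    geom (suc m + n) x                               ≈⟨ geom-suc (m + n) x ⟩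
    1# ⊕ x ⊗ geom (m + n) x                          ≈⟨ +-congˡ (*-congˡ (geom-+ m n x)) ⟩
    1# ⊕ x ⊗ (geom m x ⊕ x ^ m ⊗ geom n x)
      ≈⟨ solve 5 (λ e y s t u → e :+ y :* (s :+ t :* u) := e :+ y :* s :+ y :* t :* u) refl
           1# x (geom m x) (x ^ m) (geom n x) ⟩
    1# ⊕ x ⊗ geom m x ⊕ x ^ suc m ⊗ geom n x         ≈⟨ +-congʳ (geom-suc m x) ⟨
    geom (suc m) x ⊕ x ^ suc m ⊗ geom n x            ∎

  -- The `m * n` powers fall into `m` blocks of `n` consecutive ones, and each block is `x ^ n`
  -- times the block before it.
  geom-* : ∀ m n x → geom (m * n) x ≈ geom n x ⊗ geom m (x ^ n)
  geom-* zero    n x = sym (zeroʳ (geom n x))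
  geom-* (suc m) n x = begin
    geom (n + m * n) x                               ≈⟨ geom-+ n (m * n) x ⟩
    geom n x ⊕ x ^ n ⊗ geom (m * n) x                ≈⟨ +-cong (sym (*-identityʳ _)) (*-congˡ (geom-* m n x)) ⟩
    geom n x ⊗ 1# ⊕ x ^ n ⊗ (geom n x ⊗ geom m (x ^ n))
      ≈⟨ solve 4 (λ e s y t → s :* e :+ y :* (s :* t) := s :* (e :+ y :* t)) refl
           1# (geom n x) (x ^ n) (geom m (x ^ n)) ⟩
    geom n x ⊗ (1# ⊕ x ^ n ⊗ geom m (x ^ n))         ≈⟨ *-congˡ (geom-suc m (x ^ n)) ⟨
    geom n x ⊗ geom (suc m) (x ^ n)                  ∎

  geom-fib-+ : ∀ b d x →
    geom (fib (suc b + d)) x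
      ≈ geom (fib (suc b)) x ⊗ geom (fib (suc d)) (x ^ fib (suc b))
        ⊕ x ^ (fib (suc b) * fib (suc d)) ⊗ (geom (fib b) (x ^ fib d) ⊗ geom (fib d) x)
  geom-fib-+ b d x = begin
    geom (fib (suc b + d)) x                         ≡⟨ cong (λ m → geom m x) (fib-+ b d) ⟩
    geom (A * D + B * C) x                           ≈⟨ geom-+ (A * D) (B * C) x ⟩
    geom (A * D) x ⊕ x ^ (A * D) ⊗ geom (B * C) x
      -- The product is swapped to cut this part into blocks of length `A`, giving `geom A x`. The
      -- other part is cut into blocks of length `C`, which leaves `geom C x` in base `x`, ready to
      -- be split again.
      ≡⟨ cong (λ m → geom m x ⊕ x ^ (A * D) ⊗ geom (B * C) x) (ℕ.*-comm A D) ⟩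
    geom (D * A) x ⊕ x ^ (A * D) ⊗ geom (B * C) x
      ≈⟨ +-cong (geom-* D A x) (*-congˡ (trans (geom-* B C x) (*-comm _ _))) ⟩
    geom A x ⊗ geom D (x ^ A) ⊕ x ^ (A * D) ⊗ (geom B (x ^ C) ⊗ geom C x) ∎
    where
    A = fib (suc b)
    B = fib b
    C = fib d
    D = fib (suc d)

  -- For `k = 0` the reversed range holds `f 0` alone, so the signed sum cancels the leading `f 0`.
  -- For larger `k` the reversed range is empty.
  ∑-from-1 : ∀ k f →
    let ∑ = foldRange +-rawMonoid in
    f 0 ⊕ (∑ 1 k f ⊖ ∑ k 1 f) ≈ ∑ 0 k f
  ∑-from-1 zero    f = begin
    f 0 ⊕ (0# ⊖ (f 0 ⊕ 0#))  ≈⟨ +-assoc (f 0) 0# _ ⟨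
    f 0 ⊕ 0# ⊖ (f 0 ⊕ 0#)    ≈⟨ -‿inverseʳ (f 0 ⊕ 0#) ⟩
    0#                       ∎
  ∑-from-1 (suc k) f = +-congˡ (trans (+-congˡ -[empty]≈0#) (+-identityʳ _))
    where
    open RingProperties ring using (-0#≈0#)
    -[empty]≈0# : ⊖ foldRange +-rawMonoid (suc k) 1 f ≈ 0#
    -- The reversed range has length `0 ∸ k`, which is stuck for a variable `k`.
    -[empty]≈0# rewrite ℕ.0∸n≡0 k = -0#≈0#

  -- The telescoping expansion.

  module Expansion (n b : ℕ) (x : Carrier) where
    a = suc b

    degree : ℕ → ℕ
    degree j = fib (n + 2 ∸ j * a)

    -- The bound is `i + 1` rather than `suc i` to match the ranges of the theorem definitionally.
    exponent : ℕ → ℕ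
    exponent i = ∑ℕ 1 (i + 1) degree

    factor : ℕ → Carrier
    factor j = geom (fib b) (x ^ fib (n + 1 ∸ j * a))

    product : ℕ → Carrier
    product i = foldRange *-rawMonoid 1 (i + 1) factor

    summand : ℕ → Carrier
    summand i = x ^ (fib a * exponent i) ⊗ product i ⊗ geom (fib (n + 2 ∸ (i + 1) * a)) (x ^ fib a)

    remainder : ℕ → Carrier
    remainder i = x ^ (fib a * exponent i) ⊗ product i ⊗ geom (fib (n + 1 ∸ i * a)) x

    remainder-0 : remainder 0 ≈ geom (fib (n + 1)) x
    -- The empty sum and product already compute; only `fib a * 0` has to be rewritten.
    remainder-0 rewrite ℕ.*-zeroʳ (fib a) = trans (*-congʳ (*-identityˡ _)) (*-identityˡ _)

    -- The bound on `suc i * a` ensures that at least `a` can be taken from the index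
    -- `n + 1 ∸ i * a` without truncation, so `geom-fib-+` applies to the last factor.
    remainder-step : ∀ i → suc i * a ≤ n →
                     remainder i ≈ geom (fib a) x ⊗ summand i ⊕ remainder (suc i)
    remainder-step i le = begin
      X ⊗ P ⊗ geom (fib (n + 1 ∸ i * a)) x           ≡⟨ cong (λ m → X ⊗ P ⊗ geom (fib m) x) n+1∸ia ⟩
      X ⊗ P ⊗ geom (fib (a + d)) x                   ≈⟨ *-congˡ (geom-fib-+ b d x) ⟩
      X ⊗ P ⊗ (G ⊗ H ⊕ x ^ (fib a * fib (suc d)) ⊗ (K ⊗ L))
        -- The new power joins `X` and `K`, which is `factor (suc i)`, joins `P`; `L` is the last
        -- factor of the next remainder.
        ≈⟨ solve 7 (λ s p g h y k l → s :* p :* (g :* h :+ y :* (k :* l))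
                                    := g :* (s :* p :* h) :+ s :* y :* (p :* k) :* l) refl
             X P G H (x ^ (fib a * fib (suc d))) K L ⟩
      G ⊗ (X ⊗ P ⊗ H) ⊕ X ⊗ x ^ (fib a * fib (suc d)) ⊗ (P ⊗ K) ⊗ L
        ≈⟨ +-cong (*-congˡ (*-congˡ (reflexive (cong (λ m → geom (fib m) (x ^ fib a)) (≡.sym n+2∸[i+1]a)))))
                  (*-congʳ (*-cong power (sym (foldRange-snoc₁ *-monoid i factor)))) ⟩
      G ⊗ summand i ⊕ remainder (suc i)              ∎
      where
      d = n + 1 ∸ suc i * a
      X = x ^ (fib a * exponent i)
      P = product i
      G = geom (fib a) x
      H = geom (fib (suc d)) (x ^ fib a)
      K = geom (fib b) (x ^ fib d)
      L = geom (fib d) x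

      n+2∸[1+i]a : n + 2 ∸ suc i * a ≡ suc d
      n+2∸[1+i]a rewrite ℕ.+-suc n 1 = ℕ.+-∸-assoc 1 (ℕ.≤-trans le (ℕ.m≤m+n n 1))

      -- `summand i` contains `(i + 1) * a`, while `degree (suc i)` contains `suc i * a`; both forms
      -- occur.
      n+2∸[i+1]a : n + 2 ∸ (i + 1) * a ≡ suc d
      n+2∸[i+1]a rewrite ℕ.+-comm i 1 = n+2∸[1+i]a

      n+1∸ia : n + 1 ∸ i * a ≡ a + d
      n+1∸ia = n∸m≡o+[n∸[o+m]] (n + 1) (i * a) a (ℕ.≤-trans le (ℕ.m≤m+n n 1))

      power : X ⊗ x ^ (fib a * fib (suc d)) ≈ x ^ (fib a * exponent (suc i))
      power = begin
        X ⊗ x ^ (fib a * fib (suc d))                ≈⟨ ^-homo-* x (fib a * exponent i) _ ⟨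
        x ^ (fib a * exponent i + fib a * fib (suc d)) ≡⟨ cong (x ^_) (ℕ.*-distribˡ-+ (fib a) (exponent i) _) ⟨
        x ^ (fib a * (exponent i + fib (suc d)))     ≡⟨ cong (λ m → x ^ (fib a * (exponent i + fib m))) n+2∸[1+i]a ⟨
        x ^ (fib a * (exponent i + fib (n + 2 ∸ suc i * a)))
          ≡⟨ cong (λ m → x ^ (fib a * m)) (foldRange-snoc₁ ℕ.+-0-monoid i degree) ⟨
        x ^ (fib a * exponent (suc i))               ∎

    -- Starting the sum at index 0 makes the leading term an ordinary summand, so every induction
    -- step is one `remainder-step`.
    telescope : ∀ k → k * a ≤ n →
      geom (fib (n + 1)) x ≈ geom (fib a) x ⊗ foldRange +-rawMonoid 0 k summand ⊕ remainder k
    telescope zero    _  = sym (trans (+-cong (zeroʳ _) remainder-0) (+-identityˡ _))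
    telescope (suc k) le = begin
      geom (fib (n + 1)) x                           ≈⟨ telescope k (ℕ.≤-trans (ℕ.m≤n+m (k * a) a) le) ⟩
      G ⊗ S ⊕ remainder k                            ≈⟨ +-congˡ (remainder-step k le) ⟩
      G ⊗ S ⊕ (G ⊗ summand k ⊕ remainder (suc k))    ≈⟨ +-assoc _ _ _ ⟨
      G ⊗ S ⊕ G ⊗ summand k ⊕ remainder (suc k)      ≈⟨ +-congʳ (distribˡ G S (summand k)) ⟨
      G ⊗ (S ⊕ summand k) ⊕ remainder (suc k)        ≈⟨ +-congʳ (*-congˡ (foldRange-snoc +-monoid k summand)) ⟨
      G ⊗ foldRange +-rawMonoid 0 (suc k) summand ⊕ remainder (suc k) ∎
      where
      G = geom (fib a) x
      S = foldRange +-rawMonoid 0 k summand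

    summand-0 : summand 0 ≈ geom (fib (n + 2 ∸ a)) (x ^ fib a)
    -- `(0 + 1) * a` computes to `suc (b + 0)`, hence the rewrite at `b`.
    summand-0 rewrite ℕ.*-zeroʳ (fib a) | ℕ.+-identityʳ b =
      trans (*-congʳ (*-identityˡ _)) (*-identityˡ _)

    expansion : ∀ k → k * a ≤ n →
      geom (fib (n + 1)) x
        ≈ geom (fib (n + 2 ∸ a)) (x ^ fib a) ⊗ geom (fib a) x
          ⊕ geom (fib a) x ⊗ (foldRange +-rawMonoid 1 k summand ⊖ foldRange +-rawMonoid k 1 summand)
          ⊕ remainder k
    expansion k le = begin
      geom (fib (n + 1)) x                                  ≈⟨ telescope k le ⟩
      G ⊗ foldRange +-rawMonoid 0 k summand ⊕ remainder k   ≈⟨ +-congʳ (*-congˡ (∑-from-1 k summand)) ⟨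
      G ⊗ (summand 0 ⊕ S) ⊕ remainder k                     ≈⟨ +-congʳ (distribˡ G (summand 0) S) ⟩
      G ⊗ summand 0 ⊕ G ⊗ S ⊕ remainder k
        ≈⟨ +-congʳ (+-congʳ (trans (*-congˡ summand-0) (*-comm G _))) ⟩
      geom (fib (n + 2 ∸ a)) (x ^ fib a) ⊗ G ⊕ G ⊗ S ⊕ remainder k ∎
      where
      G = geom (fib a) x
      S = foldRange +-rawMonoid 1 k summand ⊖ foldRange +-rawMonoid k 1 summand

proposition2p6 :
    (n a : ℕ) .{{_ : NonZero a}} → 1 ≤ n → 1 ≤ a → a ≤ n + 1 →
    ⟦ fib (n + 1) ⟧ q
      ≈ₚ
    ⟦ fib (n + 2 ∸ a) ⟧ (q ^ₚ fib a) *ₚ ⟦ fib a ⟧ q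
      +ₚ
    ⟦ fib a ⟧ q *ₚ
      (∑±[ 1 ≤ i < n / a ]
        (q ^ₚ (fib a * (∑ℕ[ 1 ≤ j < i + 1 ] fib (n + 2 ∸ j * a)))
          *ₚ (∏ₚ[ 1 ≤ j < i + 1 ] ⟦ fib (a ∸ 1) ⟧ (q ^ₚ fib (n + 1 ∸ j * a)))
          *ₚ ⟦ fib (n + 2 ∸ (i + 1) * a) ⟧ (q ^ₚ fib a)))
      +ₚ
    q ^ₚ (fib a * (∑ℕ[ 1 ≤ j < n / a + 1 ] fib (n + 2 ∸ j * a)))
      *ₚ (∏ₚ[ 1 ≤ j < n / a + 1 ] ⟦ fib (a ∸ 1) ⟧ (q ^ₚ fib (n + 1 ∸ j * a)))
      *ₚ ⟦ fib (n + 1 ∸ (n / a) * a) ⟧ q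
proposition2p6 n a@(suc b) _ _ _ =
  -- Matching `a` as `suc b` reduces `a ∸ 1` to `b`; the bound required at `k = n / a` is that the
  -- quotient times the divisor does not exceed `n`.
  Expansion.expansion ℤ[q]-commutativeRing n b q (n / a) (m/n*n≤m n a)
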